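{- Let $\mathbf{A}$ be a normal and quasicomplemented distributive nearlattice. Then every prime $\alpha$-ideal of $A$ is a maximal ideal.
   Context: A distributive nearlattice is a join-semilattice $\langle A,\vee,1\rangle$ with greatest element $1$ in which every principal filter $[a)=\{x\in A\colon a\le x\}$ is a bounded distributive lattice. An ideal of $A$ is a subset $I$ that is downward closed and closed under $\vee$. A prime ideal is a non-empty proper ideal $P$ such that $a\wedge b\in P$ implies $a\in P$ or $b\in P$ whenever $a\wedge b$ exists. A maximal ideal is a non-empty proper ideal $I$ such that for every ideal $J\supseteq I$, $J=I$ or $J=A$. For $a\in A$, $a^{\top}=\{x\in A\colon x\vee a=1\}$ and $a^{\top\top}=\{y\in A\colon y\vee x=1\text{ for all }x\in a^{\top}\}$. An ideal $I$ is an $\alpha$-ideal if for each $a\in A$, $I\cap a^{\top\top}\ne\emptyset$ implies $a\in I$. $\mathbf{A}$ is normal if each prime ideal is contained in a unique maximal ideal. $\mathbf{A}$ is quasicomplemented if for each $a\in A$ there exists $b\in A$ with $a^{\top\top}=b^{\top}$. -}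

module Defs where

open import Level using (Level; suc; _⊔_)
open import Data.Product using (Σ; ∃; _×_; _,_)
open import Data.Sum using (_⊎_)
open import Relation.Nullary using (¬_)
open import Relation.Binary.PropositionalEquality using (_≡_)
open import Relation.Unary using (Pred; _∈_; _∉_; _⊆_)

-- A join-semilattice ⟨A, ∨, 1⟩ with greatest element 1, with order
-- x ≤ y :⟺ x ∨ y ≡ y, such that every principal filter [a) is a
-- bounded distributive lattice (bottom a, top 1, join ∨, meets exist).
record DistNearlattice (ℓ : Level) : Set (suc ℓ) where
  infixl 6 _∨_
  infix 4 _≤_
  field
    Carrier : Set ℓ
    _∨_     : Carrier → Carrier → Carrier
    𝟏       : Carrier
    ∨-assoc : ∀ x y z → (x ∨ y) ∨ z ≡ x ∨ (y ∨ z)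
    ∨-comm  : ∀ x y → x ∨ y ≡ y ∨ x
    ∨-idem  : ∀ x → x ∨ x ≡ x
    ∨-top   : ∀ x → x ∨ 𝟏 ≡ 𝟏

  _≤_ : Carrier → Carrier → Set ℓ
  x ≤ y = x ∨ y ≡ y

  IsMeetIn : Carrier → Carrier → Carrier → Carrier → Set ℓ
  IsMeetIn a m x y =
    a ≤ m × m ≤ x × m ≤ y × (∀ z → a ≤ z → z ≤ x → z ≤ y → z ≤ m)

  field
    filter-meet : ∀ a x y → a ≤ x → a ≤ y → Σ Carrier (λ m → IsMeetIn a m x y)
    filter-distrib : ∀ a x y z m₁ m₂ m₃ → a ≤ x → a ≤ y → a ≤ z →
      IsMeetIn a m₁ x (y ∨ z) → IsMeetIn a m₂ x y → IsMeetIn a m₃ x z →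
      m₁ ≡ m₂ ∨ m₃

  -- m is the meet a ∧ b in A (so "a ∧ b exists" means Σ m, IsMeet m a b)
  IsMeet : Carrier → Carrier → Carrier → Set ℓ
  IsMeet m x y = m ≤ x × m ≤ y × (∀ z → z ≤ x → z ≤ y → z ≤ m)

  Subset : Set (suc ℓ)
  Subset = Pred Carrier ℓ

  _≐_ : Subset → Subset → Set ℓ
  I ≐ J = I ⊆ J × J ⊆ I

  IsIdeal : Subset → Set ℓ
  IsIdeal I = (∀ {x y} → x ≤ y → y ∈ I → x ∈ I)
            × (∀ {x y} → x ∈ I → y ∈ I → (x ∨ y) ∈ I)

  NonEmpty : Subset → Set ℓ
  NonEmpty I = Σ Carrier (λ x → x ∈ I)

  Proper : Subset → Set ℓ
  Proper I = ¬ (∀ x → x ∈ I)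

  IsPrimeIdeal : Subset → Set ℓ
  IsPrimeIdeal P = IsIdeal P × NonEmpty P × Proper P
    × (∀ a b m → IsMeet m a b → m ∈ P → a ∈ P ⊎ b ∈ P)

  IsMaximalIdeal : Subset → Set (suc ℓ)
  IsMaximalIdeal I = IsIdeal I × NonEmpty I × Proper I
    × (∀ (J : Subset) → IsIdeal J → I ⊆ J → (J ≐ I) ⊎ (∀ x → x ∈ J))

  _^⊤ : Carrier → Subset
  (a ^⊤) x = x ∨ a ≡ 𝟏

  _^⊤⊤ : Carrier → Subset
  (a ^⊤⊤) y = ∀ x → x ∈ (a ^⊤) → y ∨ x ≡ 𝟏

  IsαIdeal : Subset → Set ℓ
  IsαIdeal I = IsIdeal I ×
    (∀ a → Σ Carrier (λ x → x ∈ I × x ∈ (a ^⊤⊤)) → a ∈ I)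

  IsNormal : Set (suc ℓ)
  IsNormal = ∀ (P : Subset) → IsPrimeIdeal P →
    Σ Subset (λ M → IsMaximalIdeal M × P ⊆ M ×
      (∀ (M' : Subset) → IsMaximalIdeal M' → P ⊆ M' → M' ≐ M))

  IsQuasicomplemented : Set ℓ
  IsQuasicomplemented = ∀ a → Σ Carrier (λ b → (a ^⊤⊤) ≐ (b ^⊤))

{-# OPTIONS --safe #-}

-- Let P be a prime α-ideal, p ∈ P, and let b be a quasicomplement of a.  The
-- meet d of a ∨ p and b ∨ p in [p) satisfies d^⊤ ⊆ p^⊤, because z ∨ d = 1 puts
-- z ∨ p in a^⊤ ∩ b^⊤ = a^⊤ ∩ a^⊤⊤ = {1}.  Hence p ∈ d^⊤⊤, so d ∈ P as P is an
-- α-ideal, and a ∈ P or b ∈ P as P is prime.  If M is a proper ideal containing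
-- P and a ∈ M, then b ∉ M since a ∨ b = 1, so a ∈ P; thus P = M.

module Submission where

open import Defs
open import Level using (Level)
open import Data.Empty using (⊥-elim)
open import Data.Product using (_,_; proj₂)
open import Data.Sum using (_⊎_; inj₁; inj₂)
open import Function using (_∘_)
open import Relation.Binary.PropositionalEquality using (_≡_; sym; trans; cong; subst; module ≡-Reasoning)
open import Relation.Unary using (_∈_; _∉_; _⊆_)

module _ {ℓ : Level} (A : DistNearlattice ℓ) where
  open DistNearlattice A
  open ≡-Reasoning

  x≤x∨y : ∀ x y → x ≤ x ∨ y
  x≤x∨y x y = trans (sym (∨-assoc x x y)) (cong (_∨ y) (∨-idem x))

  y≤x∨y : ∀ x y → y ≤ x ∨ y
  y≤x∨y x y = subst (y ≤_) (∨-comm y x) (x≤x∨y y x)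

  ≤-trans : ∀ {x y z} → x ≤ y → y ≤ z → x ≤ z
  ≤-trans {x} {y} {z} x≤y y≤z = begin
    x ∨ z        ≡⟨ cong (x ∨_) y≤z ⟨
    x ∨ (y ∨ z)  ≡⟨ ∨-assoc x y z ⟨
    (x ∨ y) ∨ z  ≡⟨ cong (_∨ z) x≤y ⟩
    y ∨ z        ≡⟨ y≤z ⟩
    z            ∎

  ∨-least : ∀ {x y z} → x ≤ z → y ≤ z → x ∨ y ≤ z
  ∨-least {x} {y} {z} x≤z y≤z = begin
    (x ∨ y) ∨ z  ≡⟨ ∨-assoc x y z ⟩
    x ∨ (y ∨ z)  ≡⟨ cong (x ∨_) y≤z ⟩
    x ∨ z        ≡⟨ x≤z ⟩
    z            ∎

  ∨≡𝟏-monoʳ : ∀ z {x y} → x ≤ y → z ∨ x ≡ 𝟏 → z ∨ y ≡ 𝟏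
  ∨≡𝟏-monoʳ z {x} {y} x≤y z∨x≡𝟏 = begin
    z ∨ y        ≡⟨ cong (z ∨_) x≤y ⟨
    z ∨ (x ∨ y)  ≡⟨ ∨-assoc z x y ⟨
    (z ∨ x) ∨ y  ≡⟨ cong (_∨ y) z∨x≡𝟏 ⟩
    𝟏 ∨ y        ≡⟨ ∨-comm 𝟏 y ⟩
    y ∨ 𝟏        ≡⟨ ∨-top y ⟩
    𝟏            ∎

  -- A common lower bound `z` of `x` and `y` may lie outside the filter of `a`; `z ∨ a` lies inside
  -- it and is still a lower bound.
  IsMeetIn⇒IsMeet : ∀ {a m x y} → a ≤ x → a ≤ y → IsMeetIn a m x y → IsMeet m x y
  IsMeetIn⇒IsMeet {a} a≤x a≤y (_ , m≤x , m≤y , greatest) =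
    m≤x , m≤y , λ z z≤x z≤y →
      ≤-trans (x≤x∨y z a)
        (greatest (z ∨ a) (y≤x∨y z a) (∨-least z≤x a≤x) (∨-least z≤y a≤y))

  𝟏∉Proper : ∀ {I} → IsIdeal I → Proper I → 𝟏 ∉ I
  𝟏∉Proper (down , _) proper 𝟏∈I = proper (λ x → down (∨-top x) 𝟏∈I)

  a∈a^⊤⊤ : ∀ a → a ∈ (a ^⊤⊤)
  a∈a^⊤⊤ a x x∨a≡𝟏 = trans (∨-comm a x) x∨a≡𝟏

  primeα-quasicomplement : ∀ {P} → IsPrimeIdeal P → IsαIdeal P →
    ∀ a b → (b ^⊤) ⊆ (a ^⊤⊤) → a ∈ P ⊎ b ∈ P
  primeα-quasicomplement {P} ((down , _) , (p , p∈P) , _ , prime) (_ , α) a b b^⊤⊆a^⊤⊤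
    -- `a` and `b` may have no meet; joining both with `p` moves them into the filter of `p`, where
    -- meets exist.
    with filter-meet p (a ∨ p) (b ∨ p) (y≤x∨y a p) (y≤x∨y b p)
  ... | d , meet@(_ , d≤a∨p , d≤b∨p , _)
    with prime (a ∨ p) (b ∨ p) d (IsMeetIn⇒IsMeet (y≤x∨y a p) (y≤x∨y b p) meet)
           (α d (p , p∈P , p∈d^⊤⊤))
    where
    swap : ∀ z {c} → d ≤ c ∨ p → z ∨ d ≡ 𝟏 → (z ∨ p) ∨ c ≡ 𝟏
    swap z {c} d≤c∨p z∨d≡𝟏 = begin
      (z ∨ p) ∨ c  ≡⟨ ∨-assoc z p c ⟩
      z ∨ (p ∨ c)  ≡⟨ cong (z ∨_) (∨-comm p c) ⟩
      z ∨ (c ∨ p)  ≡⟨ ∨≡𝟏-monoʳ z d≤c∨p z∨d≡𝟏 ⟩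
      𝟏            ∎

    p∈d^⊤⊤ : p ∈ (d ^⊤⊤)
    p∈d^⊤⊤ z z∨d≡𝟏 = begin
      p ∨ z              ≡⟨ ∨-comm p z ⟩
      -- Doubling `z ∨ p` lets it be used twice: as a member of `b ^⊤`, hence of `a ^⊤⊤`, and as a
      -- member of `a ^⊤`.
      z ∨ p              ≡⟨ ∨-idem (z ∨ p) ⟨
      (z ∨ p) ∨ (z ∨ p)  ≡⟨ b^⊤⊆a^⊤⊤ (swap z d≤b∨p z∨d≡𝟏) (z ∨ p) (swap z d≤a∨p z∨d≡𝟏) ⟩
      𝟏                  ∎
  ... | inj₁ a∨p∈P = inj₁ (down (x≤x∨y a p) a∨p∈P)
  ... | inj₂ b∨p∈P = inj₂ (down (x≤x∨y b p) b∨p∈P)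

  proper⊆primeα : IsQuasicomplemented → ∀ {P M} → IsPrimeIdeal P → IsαIdeal P →
    IsIdeal M → Proper M → P ⊆ M → M ⊆ P
  proper⊆primeα quasi {P} {M} P-prime P-α M-ideal M-proper P⊆M {a} a∈M with quasi a
  ... | b , a^⊤⊤⊆b^⊤ , b^⊤⊆a^⊤⊤ with primeα-quasicomplement P-prime P-α a b b^⊤⊆a^⊤⊤
  ... | inj₁ a∈P = a∈P
  -- From `a ∈ (a ^⊤⊤)` follows `a ∨ b ≡ 𝟏`, so `M` would contain `𝟏`.
  ... | inj₂ b∈P = ⊥-elim (𝟏∉Proper M-ideal M-proper
          (subst M (a^⊤⊤⊆b^⊤ (a∈a^⊤⊤ a)) (proj₂ M-ideal a∈M (P⊆M b∈P))))

-- Normality supplies a maximal ideal M ⊇ P; constructively it is the maximality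
-- of M that decides, for J ⊇ P, whether J = P or J = A.
theorem3p9 : ∀ {ℓ : Level} (A : DistNearlattice ℓ) →
    DistNearlattice.IsNormal A → DistNearlattice.IsQuasicomplemented A →
    ∀ (P : DistNearlattice.Subset A) →
    DistNearlattice.IsPrimeIdeal A P → DistNearlattice.IsαIdeal A P →
    DistNearlattice.IsMaximalIdeal A P
theorem3p9 A normal quasi P P-prime@(P-ideal , P-nonEmpty , P-proper , _) P-α
  with normal P P-prime
... | M , (M-ideal , _ , M-proper , M-max) , P⊆M , _ =
  P-ideal , P-nonEmpty , P-proper , maximal
  where
  open DistNearlattice A

  M⊆P : M ⊆ P
  M⊆P = proper⊆primeα A quasi P-prime P-α M-ideal M-proper P⊆M

  maximal : ∀ J → IsIdeal J → P ⊆ J → (J ≐ P) ⊎ (∀ x → x ∈ J)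
  -- `M ⊆ P ⊆ J`, so the maximality of `M` applies to `J`.
  maximal J J-ideal P⊆J with M-max J J-ideal (P⊆J ∘ M⊆P)
  ... | inj₁ (J⊆M , _) = inj₁ (M⊆P ∘ J⊆M , P⊆J)
  ... | inj₂ J-total = inj₂ J-total
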